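{- Let $k\ge1$, and let $a,b$ be integers with $b\ge1$, $0\le a\le b$ and $k\equiv a\pmod b$. Then $N\big((k+1+a-b)(k-a)/b,\;k\big)=(k-a)/b$.
   Context: For $n>k\ge1$, $N(n,k)$ is the nullity of the $n\times n$ skew-symmetric Toeplitz matrix $A(n,k)$ whose first $k$ superdiagonals have all entries $1$ and whose remaining superdiagonals have all entries $0$. This nullity depends only on $n\bmod (k^2+k)$, and $N(n,k)$ is defined for every integer $n$ as $N(n',k)$ for any $n'>k$ with $n'\equiv n\pmod{k^2+k}$. -}

module Defs where

open import Data.Bool using (if_then_else_)
open import Data.Fin using (Fin; toℕ)
open import Data.Integer as ℤ using (ℤ; +_)
import Data.Integer.Divisibility.Signed as ℤ
open import Data.Nat as ℕ using (ℕ)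
open import Data.Product using (∃-syntax; _×_)
open import Data.Rational using (ℚ; 0ℚ; 1ℚ; _*_; _-_)
open import Data.Rational.Properties using (+-0-commutativeMonoid)
open import Data.Vec.Functional using (Vector)
open import Relation.Binary.PropositionalEquality using (_≡_; _≗_)
open import Relation.Nullary using (does)
open import Relation.Nullary.Decidable using (_×-dec_)
open import Algebra.Properties.CommutativeMonoid.Sum +-0-commutativeMonoid using (sum)

Matrix : ℕ → ℕ → Set
Matrix m n = Fin m → Fin n → ℚ

infixr 7 _*ᵥ_

_*ᵥ_ : ∀ {m n} → Matrix m n → Vector ℚ n → Vector ℚ m
(M *ᵥ v) i = sum (λ j → M i j * v j)

𝟎 : ∀ {n} → Vector ℚ n
𝟎 _ = 0ℚ

InKernel : ∀ {m n} → Matrix m n → Vector ℚ n → Set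
InKernel M v = M *ᵥ v ≗ 𝟎

linearCombination : ∀ {n d} → Vector ℚ d → Vector (Vector ℚ n) d → Vector ℚ n
linearCombination c B i = sum (λ l → c l * B l i)

LinearlyIndependent : ∀ {n d} → Vector (Vector ℚ n) d → Set
LinearlyIndependent B = ∀ c → linearCombination c B ≗ 𝟎 → c ≗ 𝟎

record IsKernelBasis {m n d} (M : Matrix m n) (B : Vector (Vector ℚ n) d) : Set where
  field
    inKernel    : ∀ l → InKernel M (B l)
    independent : LinearlyIndependent B
    spanning    : ∀ v → InKernel M v → ∃[ c ] v ≗ linearCombination c B

-- The dimension of the kernel of M is d.
HasNullity : ∀ {m n} → Matrix m n → ℕ → Set
HasNullity {n = n} M d = ∃[ B ] IsKernelBasis {n = n} {d = d} M B

-- The s-th superdiagonal consists of the positions (i , j) with j = i + s, so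
-- the first k superdiagonals are the positions with i < j ≤ i + k.
band : ∀ n → ℕ → Matrix n n
band n k i j =
  if does ((toℕ i ℕ.<? toℕ j) ×-dec (toℕ j ℕ.≤? toℕ i ℕ.+ k)) then 1ℚ else 0ℚ

A : ∀ n → ℕ → Matrix n n
A n k i j = band n k i j - band n k j i

infix 4 _≡_[mod_]

_≡_[mod_] : ℤ → ℤ → ℤ → Set
x ≡ y [mod m ] = m ℤ.∣ x ℤ.- y

-- N⟨ n , k ⟩≡ d says N(n,k) = d for an arbitrary integer n.  For k ≥ 1 every
-- residue class modulo k² + k contains some n′ > k, so this is never vacuous,
-- and it includes the independence of the choice of n′.
N⟨_,_⟩≡_ : ℤ → ℕ → ℕ → Set
N⟨ n , k ⟩≡ d =
  ∀ n′ → k ℕ.< n′ → + n′ ≡ n [mod + (k ℕ.* k ℕ.+ k) ] → HasNullity (A n′ k) d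

{-# OPTIONS --safe #-}

-- Extend a kernel vector v by zeros.  Row i says that the k entries after i and the k entries
-- before i have equal sums; call this common value g i.  Then g is (k+1)-periodic with g 0 = 0,
-- and v p = g (p + 1 + ⌊p/k⌋) − g p.  Conversely every such g gives a kernel vector as soon as
-- this expression vanishes for n ≤ p < n + k.  These k conditions identify values of g along the
-- cycles of a permutation of ℤ/(k+1) depending only on n modulo k² + k, so the nullity is the
-- number of cycles not containing 0.  For k = a + bd = a(d+1) + (b−a)d and n = (k+1+a−b)d the
-- permutation steps by d + 1 on one interval and by d on another, and has d + 1 cycles.
module Submission where

open import Defs

module BandKernel where

  open import Data.Bool using (if_then_else_)
  open import Data.Fin as Fin using (Fin; toℕ; fromℕ<)
  open import Data.Fin.Properties using (toℕ<n; toℕ-fromℕ<)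
  open import Data.Nat using (ℕ; zero; suc; _+_; _*_; _∸_; _≤_; _<_; _<?_; _≤?_; _≡ᵇ_; z≤n; s≤s; _/_; _%_; NonZero; ≢-nonZero⁻¹)
  open import Data.Nat.DivMod
  open import Data.Nat.Divisibility using (∣-refl; n∣m*n)
  open import Data.Nat.Induction using (<-rec)
  open import Data.Nat.Properties
  open import Data.Nat.Tactic.RingSolver using (solve-∀)
  open import Data.Product using (∃-syntax; _×_; _,_)
  open import Data.Rational as ℚ using (ℚ; 0ℚ; 1ℚ)
  import Data.Rational.Properties as ℚ
  open import Data.Rational.Solver using (module +-*-Solver)
  open import Data.Sum using (inj₁; inj₂)
  open import Data.Vec.Functional using (Vector)
  open import Function using (_∘_)
  open import Relation.Binary.PropositionalEquality
  open import Relation.Nullary using (¬_; does; yes; no; contradiction)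
  open import Relation.Nullary.Decidable using (_×-dec_; dec-true; dec-false)
  open import Algebra.Properties.CommutativeMonoid.Sum ℚ.+-0-commutativeMonoid using (sum-replicate-zero) renaming (sum to ∑; sum-cong-≗ to ∑-cong)
  open import Algebra.Properties.Group ℚ.+-0-group using () renaming (x∙y⁻¹≈ε⇒x≈y to p-q≡0⇒p≡q; x≈y⇒x∙y⁻¹≈ε to p≡q⇒p-q≡0)

  -- Finite sums and partial sums of rational sequences.

  ∑-zero : ∀ {n} {f : Vector ℚ n} → f ≗ 𝟎 → ∑ f ≡ 0ℚ
  ∑-zero {n} f≗0 = trans (∑-cong f≗0) (sum-replicate-zero n)

  interchange-- : ∀ p q r s → (p ℚ.- q) ℚ.+ (r ℚ.- s) ≡ (p ℚ.+ r) ℚ.- (q ℚ.+ s)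
  interchange-- = solve 4 (λ p q r s → (p :- q) :+ (r :- s) := (p :+ r) :- (q :+ s)) refl
    where
    open +-*-Solver

  *-distribʳ-- : ∀ p q r → (p ℚ.- q) ℚ.* r ≡ p ℚ.* r ℚ.- q ℚ.* r
  *-distribʳ-- = solve 3 (λ p q r → (p :- q) :* r := p :* r :- q :* r) refl
    where
    open +-*-Solver

  *-distribˡ-- : ∀ p q r → p ℚ.* (q ℚ.- r) ≡ p ℚ.* q ℚ.- p ℚ.* r
  *-distribˡ-- = solve 3 (λ p q r → p :* (q :- r) := p :* q :- p :* r) refl
    where
    open +-*-Solver

  ∑-distrib-- : ∀ {n} (f g : Vector ℚ n) → ∑ (λ i → f i ℚ.- g i) ≡ ∑ f ℚ.- ∑ g
  ∑-distrib-- {zero}  f g = refl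
  ∑-distrib-- {suc n} f g = trans
    (cong (f Fin.zero ℚ.- g Fin.zero ℚ.+_) (∑-distrib-- (f ∘ Fin.suc) (g ∘ Fin.suc)))
    (interchange-- (f Fin.zero) (g Fin.zero) _ _)

  partialSum : (ℕ → ℚ) → ℕ → ℚ
  partialSum f zero    = 0ℚ
  partialSum f (suc n) = partialSum f n ℚ.+ f n

  partialSum-cong : ∀ {f g : ℕ → ℚ} n → (∀ i → i < n → f i ≡ g i) → partialSum f n ≡ partialSum g n
  partialSum-cong zero    f≗g = refl
  partialSum-cong (suc n) f≗g =
    cong₂ ℚ._+_ (partialSum-cong n (λ i i<n → f≗g i (m<n⇒m<1+n i<n))) (f≗g n ≤-refl)

  partialSum-distrib-- : ∀ (f g : ℕ → ℚ) n →
    partialSum (λ i → f i ℚ.- g i) n ≡ partialSum f n ℚ.- partialSum g n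
  partialSum-distrib-- f g zero    = refl
  partialSum-distrib-- f g (suc n) = trans
    (cong (ℚ._+ (f n ℚ.- g n)) (partialSum-distrib-- f g n))
    (interchange-- (partialSum f n) (partialSum g n) (f n) (g n))

  partialSum-suc : ∀ (f : ℕ → ℚ) n → partialSum f (suc n) ≡ f 0 ℚ.+ partialSum (f ∘ suc) n
  partialSum-suc f zero    = trans (ℚ.+-identityˡ (f 0)) (sym (ℚ.+-identityʳ (f 0)))
  partialSum-suc f (suc n) = trans
    (cong (ℚ._+ f (suc n)) (partialSum-suc f n))
    (ℚ.+-assoc (f 0) (partialSum (f ∘ suc) n) (f (suc n)))

  ∑-partialSum : ∀ (f : ℕ → ℚ) n → ∑ {n} (f ∘ toℕ) ≡ partialSum f n
  ∑-partialSum f zero    = refl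
  ∑-partialSum f (suc n) =
    trans (cong (f 0 ℚ.+_) (∑-partialSum (f ∘ suc) n)) (sym (partialSum-suc f n))

  partialSum-segment : ∀ (f g : ℕ → ℚ) {m n} → m ≤ n → (∀ i → m ≤ i → i < n → f i ≡ g i) →
    partialSum f n ℚ.- partialSum f m ≡ partialSum g n ℚ.- partialSum g m
  partialSum-segment f g {zero} {n} z≤n f≗g =
    cong (ℚ._- 0ℚ) (partialSum-cong n λ i → f≗g i z≤n)
  partialSum-segment f g {suc m} {suc n} m≤n f≗g with m≤n⇒m<n∨m≡n m≤n
  ... | inj₂ refl = trans (ℚ.+-inverseʳ (partialSum f (suc m))) (sym (ℚ.+-inverseʳ (partialSum g (suc m))))
  ... | inj₁ (s≤s m<n) = begin
    partialSum f n ℚ.+ f n ℚ.- partialSum f (suc m)    ≡⟨ shift (partialSum f n) (f n) _ ⟩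
    partialSum f n ℚ.- partialSum f (suc m) ℚ.+ f n
      ≡⟨ cong₂ ℚ._+_ (partialSum-segment f g m<n (λ i m<i i<n → f≗g i m<i (m<n⇒m<1+n i<n))) (f≗g n m<n ≤-refl) ⟩
    partialSum g n ℚ.- partialSum g (suc m) ℚ.+ g n    ≡⟨ shift (partialSum g n) (g n) _ ⟨
    partialSum g n ℚ.+ g n ℚ.- partialSum g (suc m)    ∎
    where
    open ≡-Reasoning
    open +-*-Solver
    shift : ∀ p q r → p ℚ.+ q ℚ.- r ≡ p ℚ.- r ℚ.+ q
    shift = solve 3 (λ p q r → (p :+ q) :- r := (p :- r) :+ q) refl

  partialSum-stable : ∀ (f : ℕ → ℚ) {m n} → m ≤ n → (∀ i → m ≤ i → i < n → f i ≡ 0ℚ) →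
    partialSum f n ≡ partialSum f m
  partialSum-stable f {m} {n} m≤n f≗0 = p-q≡0⇒p≡q _ _ (begin
    partialSum f n ℚ.- partialSum f m                      ≡⟨ partialSum-segment f (λ _ → 0ℚ) m≤n f≗0 ⟩
    partialSum (λ _ → 0ℚ) n ℚ.- partialSum (λ _ → 0ℚ) m    ≡⟨ cong₂ ℚ._-_ (zeros n) (zeros m) ⟩
    0ℚ                                                     ∎)
    where
    open ≡-Reasoning
    zeros : ∀ n → partialSum (λ _ → 0ℚ) n ≡ 0ℚ
    zeros zero    = refl
    zeros (suc n) = cong (ℚ._+ 0ℚ) (zeros n)

  -- Rows of the band matrix are supported on a window of indices; this turns such a row sum into a
  -- difference of two partial sums.
  partialSum-window : ∀ (f g : ℕ → ℚ) {lo hi n} → lo ≤ hi → hi ≤ n →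
    (∀ i → i < lo → f i ≡ 0ℚ) → (∀ i → lo ≤ i → i < hi → f i ≡ g i) → (∀ i → hi ≤ i → f i ≡ 0ℚ) →
    partialSum f n ≡ partialSum g hi ℚ.- partialSum g lo
  partialSum-window f g {lo} {hi} {n} lo≤hi hi≤n below inside above = begin
    partialSum f n                        ≡⟨ partialSum-stable f hi≤n (λ i hi≤i _ → above i hi≤i) ⟩
    partialSum f hi                       ≡⟨ ℚ.+-identityʳ _ ⟨
    partialSum f hi ℚ.- 0ℚ
      ≡⟨ cong (λ q → partialSum f hi ℚ.- q) (partialSum-stable f {0} z≤n (λ i _ → below i)) ⟨
    partialSum f hi ℚ.- partialSum f lo   ≡⟨ partialSum-segment f g lo≤hi inside ⟩
    partialSum g hi ℚ.- partialSum g lo   ∎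
    where
    open ≡-Reasoning

  -- The rows of `A n k` as differences of window sums.

  extend : ∀ {n} → Vector ℚ n → ℕ → ℚ
  extend {zero}  v _       = 0ℚ
  extend {suc n} v zero    = v Fin.zero
  extend {suc n} v (suc i) = extend (v ∘ Fin.suc) i

  extend-toℕ : ∀ {n} (v : Vector ℚ n) i → extend v (toℕ i) ≡ v i
  extend-toℕ v Fin.zero    = refl
  extend-toℕ v (Fin.suc i) = extend-toℕ (v ∘ Fin.suc) i

  extend-≥ : ∀ {n} (v : Vector ℚ n) {i} → n ≤ i → extend v i ≡ 0ℚ
  extend-≥ {zero}  v         n≤i       = refl
  extend-≥ {suc n} v {suc i} (s≤s n≤i) = extend-≥ (v ∘ Fin.suc) n≤i

  extend-< : ∀ {n} (f : ℕ → ℚ) {i} → i < n → extend {n} (f ∘ toℕ) i ≡ f i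
  extend-< {n} f i<n = trans
    (cong (extend {n} (f ∘ toℕ)) (sym (toℕ-fromℕ< i<n)))
    (trans (extend-toℕ {n} (f ∘ toℕ) (fromℕ< i<n)) (cong f (toℕ-fromℕ< i<n)))

  -- `band n k i j` unfolds to this at `toℕ i` and `toℕ j`; natural-number indices make the row sums
  -- accessible to `partialSum`.
  inBand : ℕ → ℕ → ℕ → ℚ
  inBand k i j = if does ((i <? j) ×-dec (j ≤? i + k)) then 1ℚ else 0ℚ

  inBand-yes : ∀ {k i j} p → i < j → j ≤ i + k → inBand k i j ℚ.* p ≡ p
  inBand-yes {k} {i} {j} p i<j j≤i+k
    rewrite dec-true ((i <? j) ×-dec (j ≤? i + k)) (i<j , j≤i+k) = ℚ.*-identityˡ p

  inBand-no : ∀ {k i j} p → ¬ (i < j × j ≤ i + k) → inBand k i j ℚ.* p ≡ 0ℚ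
  inBand-no {k} {i} {j} p ¬band
    rewrite dec-false ((i <? j) ×-dec (j ≤? i + k)) ¬band = ℚ.*-zeroˡ p

  -- In row i the entries 1 occupy up to k columns after i, the entries -1 up to k columns before i.
  -- Truncated subtraction cuts the left window at 0, and the zeros of `extend v` fill the right
  -- window beyond n.
  A*v : ∀ {n} k (v : Vector ℚ n) i → let P = partialSum (extend v) in
    (A n k *ᵥ v) i ≡ (P (suc (toℕ i + k)) ℚ.- P (suc (toℕ i))) ℚ.- (P (toℕ i) ℚ.- P (toℕ i ∸ k))
  A*v {n} k v i = begin
    ∑ (λ j → A n k i j ℚ.* v j)
      ≡⟨ ∑-cong (λ j → cong (A n k i j ℚ.*_) (extend-toℕ v j)) ⟨
    ∑ {n} ((λ j → (inBand k i′ j ℚ.- inBand k j i′) ℚ.* f j) ∘ toℕ)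
      ≡⟨ ∑-partialSum _ n ⟩
    partialSum (λ j → (inBand k i′ j ℚ.- inBand k j i′) ℚ.* f j) n
      ≡⟨ partialSum-cong n (λ j _ → *-distribʳ-- (inBand k i′ j) (inBand k j i′) (f j)) ⟩
    partialSum (λ j → up j ℚ.- down j) n
      ≡⟨ partialSum-distrib-- up down n ⟩
    partialSum up n ℚ.- partialSum down n
      ≡⟨ cong₂ ℚ._-_ up-sum down-sum ⟩
    (P (suc (i′ + k)) ℚ.- P (suc i′)) ℚ.- (P i′ ℚ.- P (i′ ∸ k))  ∎
    where
    open ≡-Reasoning
    i′ = toℕ i
    f = extend v
    P = partialSum f
    up down : ℕ → ℚ
    up   j = inBand k i′ j ℚ.* f j
    down j = inBand k j i′ ℚ.* f j

    up-sum : partialSum up n ≡ P (suc (i′ + k)) ℚ.- P (suc i′)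
    up-sum = trans
      -- The right window can end beyond n, so the sum is first prolonged to n + k, where `extend v`
      -- contributes only zeros.
      (sym (partialSum-stable up (m≤m+n n k) λ j n≤j _ →
        trans (cong (inBand k i′ j ℚ.*_) (extend-≥ v n≤j)) (ℚ.*-zeroʳ (inBand k i′ j))))
      (partialSum-window up f (s≤s (m≤m+n i′ k)) (+-monoˡ-≤ k (toℕ<n i))
        (λ j j≤i → inBand-no (f j) λ (i<j , _) → <⇒≱ i<j (≤-pred j≤i))
        (λ j i<j j≤i+k → inBand-yes (f j) i<j (≤-pred j≤i+k))
        (λ j i+k<j → inBand-no (f j) λ (_ , j≤i+k) → <⇒≱ i+k<j j≤i+k))

    down-sum : partialSum down n ≡ P i′ ℚ.- P (i′ ∸ k)
    down-sum = partialSum-window down f (m∸n≤m i′ k) (<⇒≤ (toℕ<n i))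
      (λ j j<i∸k → inBand-no (f j) λ (_ , i≤j+k) →
        <⇒≱ j<i∸k (≤-trans (∸-monoˡ-≤ k i≤j+k) (≤-reflexive (m+n∸n≡m j k))))
      (λ j i∸k≤j j<i → inBand-yes (f j) j<i (≤-trans (m≤n+m∸n i′ k) (≤-trans (≤-reflexive (+-comm k _)) (+-monoˡ-≤ k i∸k≤j))))
      (λ j i≤j → inBand-no (f j) λ (j<i , _) → <⇒≱ j<i i≤j)

  -- Kernel vectors from periodic sequences, and conversely.

  [m+n]/n≡1+m/n : ∀ m n .{{_ : NonZero n}} → (m + n) / n ≡ suc (m / n)
  [m+n]/n≡1+m/n m n = begin
    (m + n) / n    ≡⟨ +-distrib-/-∣ʳ m ∣-refl ⟩
    m / n + n / n  ≡⟨ cong (m / n +_) (n/n≡1 n) ⟩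
    m / n + 1      ≡⟨ +-comm (m / n) 1 ⟩
    suc (m / n)    ∎
    where
    open ≡-Reasoning

  Periodic : ℕ → (ℕ → ℚ) → Set
  Periodic m g = ∀ i → g (i + m) ≡ g i

  module _ (k : ℕ) .{{_ : NonZero k}} where

    -- This solves the kernel equations at every row i ≥ 0 if g is (k+1)-periodic with g 0 = 0;
    -- g i is then the common value of the two window sums on either side of i.
    kernelSeq : (ℕ → ℚ) → ℕ → ℚ
    kernelSeq g p = g (suc (p + p / k)) ℚ.- g p

    -- kernelSeq g vanishes on n, …, n+k−1, so truncating it to length n affects no row i < n.
    Closes : ℕ → (ℕ → ℚ) → Set
    Closes n g = ∀ r → r < k → g (suc (n + r + (n + r) / k)) ≡ g (n + r)

    module _ {g : ℕ → ℚ} (periodic : Periodic (suc k) g) (g0≡0 : g 0 ≡ 0ℚ) where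

      private
        T = partialSum (kernelSeq g)

      kernelSeq-initial : ∀ {p} → p < k → kernelSeq g p ≡ g (suc p) ℚ.- g p
      kernelSeq-initial {p} p<k = cong (λ q → g (suc q) ℚ.- g p)
        (trans (cong (p +_) (m<n⇒m/n≡0 p<k)) (+-identityʳ p))

      -- The differences telescope from g 0 = 0, because p / k = 0 for p < k.
      partialSum-initial : ∀ {p} → p ≤ k → T p ≡ g p
      partialSum-initial {zero}  _   = sym g0≡0
      partialSum-initial {suc p} p<k = begin
        T p ℚ.+ kernelSeq g p
          ≡⟨ cong₂ ℚ._+_ (partialSum-initial (<⇒≤ p<k)) (kernelSeq-initial p<k) ⟩
        g p ℚ.+ (g (suc p) ℚ.- g p)
          ≡⟨ solve 2 (λ x y → x :+ (y :- x) := y) refl (g p) (g (suc p)) ⟩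
        g (suc p)  ∎
        where
        open ≡-Reasoning
        open +-*-Solver

      -- Induction on p. Raising p by k raises p / k by 1, so the first argument of g in `kernelSeq`
      -- moves by a full period k + 1. The two increments differ only in the subtracted terms g (p +
      -- k) and g p, and g p equals g (p + 1 + k).
      partialSum-step : ∀ p → T (p + k) ≡ T p ℚ.+ g (p + k)
      partialSum-step zero    = trans (partialSum-initial ≤-refl) (sym (ℚ.+-identityˡ (g k)))
      partialSum-step (suc p) = begin
        T (p + k) ℚ.+ (g (suc (p + k + (p + k) / k)) ℚ.- g (p + k))
          ≡⟨ cong₂ (λ x y → x ℚ.+ (y ℚ.- g (p + k))) (partialSum-step p) wrap ⟩
        T p ℚ.+ g (p + k) ℚ.+ (g (suc (p + p / k)) ℚ.- g (p + k))
          ≡⟨ solve 4 (λ t x y z → t :+ x :+ (y :- x) := t :+ (y :- z) :+ z) refl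
               (T p) (g (p + k)) (g (suc (p + p / k))) (g p) ⟩
        T p ℚ.+ (g (suc (p + p / k)) ℚ.- g p) ℚ.+ g p
          ≡⟨ cong (T (suc p) ℚ.+_) (trans (cong g (sym (+-suc p k))) (periodic p)) ⟨
        T (suc p) ℚ.+ g (suc (p + k))  ∎
        where
        open ≡-Reasoning
        open +-*-Solver
        arith : ∀ p k q → suc (p + k + suc q) ≡ suc (p + q) + suc k
        arith = solve-∀
        wrap : g (suc (p + k + (p + k) / k)) ≡ g (suc (p + p / k))
        wrap = trans
          (cong g (trans (cong (λ q → suc (p + k + q)) ([m+n]/n≡1+m/n p k)) (arith p k (p / k))))
          (periodic (suc (p + p / k)))

      -- A full window is handled by `partialSum-step`; for i ≤ k the window is cut at 0 and
      -- `partialSum-initial` applies. The window after i has the same sum by `partialSum-after`,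
      -- which makes row i vanish.
      partialSum-before : ∀ i → T i ℚ.- T (i ∸ k) ≡ g i
      partialSum-before i with ≤-total i k
      ... | inj₁ i≤k = begin
        T i ℚ.- T (i ∸ k)  ≡⟨ cong₂ (λ x j → x ℚ.- T j) (partialSum-initial i≤k) (m≤n⇒m∸n≡0 i≤k) ⟩
        g i ℚ.- 0ℚ         ≡⟨ ℚ.+-identityʳ (g i) ⟩
        g i                ∎
        where
        open ≡-Reasoning
      ... | inj₂ k≤i = begin
        T i ℚ.- T j              ≡⟨ cong (λ i → T i ℚ.- T j) (m∸n+n≡m k≤i) ⟨
        T (j + k) ℚ.- T j        ≡⟨ cong (ℚ._- T j) (partialSum-step j) ⟩
        T j ℚ.+ g (j + k) ℚ.- T j  ≡⟨ solve 2 (λ x y → (x :+ y) :- x := y) refl (T j) (g (j + k)) ⟩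
        g (j + k)                ≡⟨ cong g (m∸n+n≡m k≤i) ⟩
        g i                      ∎
        where
        open ≡-Reasoning
        open +-*-Solver
        j = i ∸ k

      partialSum-after : ∀ i → T (suc (i + k)) ℚ.- T (suc i) ≡ g i
      partialSum-after i = begin
        T (suc i + k) ℚ.- T (suc i)
          ≡⟨ cong (ℚ._- T (suc i)) (partialSum-step (suc i)) ⟩
        T (suc i) ℚ.+ g (suc i + k) ℚ.- T (suc i)
          ≡⟨ solve 2 (λ x y → (x :+ y) :- x := y) refl (T (suc i)) (g (suc i + k)) ⟩
        g (suc (i + k))                            ≡⟨ cong g (+-suc i k) ⟨
        g (i + suc k)                              ≡⟨ periodic i ⟩
        g i                                        ∎
        where
        open ≡-Reasoning
        open +-*-Solver

      kernelSeq-inKernel : ∀ {n} → Closes n g → InKernel (A n k) (kernelSeq g ∘ toℕ)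
      kernelSeq-inKernel {n} closes i = begin
        (A n k *ᵥ v) i
          ≡⟨ A*v k v i ⟩
        (P (suc (i′ + k)) ℚ.- P (suc i′)) ℚ.- (P i′ ℚ.- P (i′ ∸ k))
          ≡⟨ cong₂ ℚ._-_ (cong₂ ℚ._-_ (P≡T (+-monoˡ-≤ k i<n)) (P≡T (≤-trans i<n (m≤m+n n k))))
                         (cong₂ ℚ._-_ (P≡T i≤n+k) (P≡T (≤-trans (m∸n≤m i′ k) i≤n+k))) ⟩
        (T (suc (i′ + k)) ℚ.- T (suc i′)) ℚ.- (T i′ ℚ.- T (i′ ∸ k))
          ≡⟨ p≡q⇒p-q≡0 (trans (partialSum-after i′) (sym (partialSum-before i′))) ⟩
        0ℚ  ∎
        where
        open ≡-Reasoning
        v : Vector ℚ n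
        v = kernelSeq g ∘ toℕ
        P = partialSum (extend v)
        i′ = toℕ i
        i<n = toℕ<n i
        i≤n+k = ≤-trans (<⇒≤ i<n) (m≤m+n n k)

        -- Between n and n + k the closing conditions supply the zeros of the extension, and no row
        -- i < n reads any further.
        extend≡ : ∀ p → p < n + k → extend v p ≡ kernelSeq g p
        extend≡ p p<n+k with p <? n
        ... | yes p<n = extend-< (kernelSeq g) p<n
        ... | no  p≮n = trans (extend-≥ v n≤p) (sym (p≡q⇒p-q≡0
          (subst (λ p → g (suc (p + p / k)) ≡ g p) (m+[n∸m]≡n n≤p)
            (closes (p ∸ n) (+-cancelˡ-< n _ _ (subst (_< n + k) (sym (m+[n∸m]≡n n≤p)) p<n+k))))))
          where n≤p = ≮⇒≥ p≮n

        P≡T : ∀ {p} → p ≤ n + k → P p ≡ T p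
        P≡T {p} p≤n+k = partialSum-cong p λ j j<p → extend≡ j (<-≤-trans j<p p≤n+k)

    -- The sequence g is recovered from v as its window sums, which over the first k + 1
    -- indices are just the partial sums.
    inKernel⇒kernelSeq : ∀ {n} (v : Vector ℚ n) → InKernel (A n k) v →
      ∃[ g ] Periodic (suc k) g × g 0 ≡ 0ℚ × Closes n g × v ≗ kernelSeq g ∘ toℕ
    inKernel⇒kernelSeq {n} v Av≗0 = g , periodic , refl , closes , v≗
      where
      P = partialSum (extend v)

      g : ℕ → ℚ
      g i = P (i % suc k)

      periodic : Periodic (suc k) g
      periodic i = cong P ([m+n]%n≡m%n i (suc k))

      T = partialSum (kernelSeq g)

      P-recurrence : ∀ i → i < n → P (suc (i + k)) ≡ (P i ℚ.- P (i ∸ k)) ℚ.+ P (suc i)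
      P-recurrence i i<n = begin
        P (suc (i + k))
          ≡⟨ solve 2 (λ x y → x := (x :- y) :+ y) refl (P (suc (i + k))) (P (suc i)) ⟩
        (P (suc (i + k)) ℚ.- P (suc i)) ℚ.+ P (suc i)
          ≡⟨ cong (ℚ._+ P (suc i)) (p-q≡0⇒p≡q (P (suc (i + k)) ℚ.- P (suc i)) (P i ℚ.- P (i ∸ k)) equation) ⟩
        (P i ℚ.- P (i ∸ k)) ℚ.+ P (suc i)  ∎
        where
        open ≡-Reasoning
        open +-*-Solver
        equation : (P (suc (i + k)) ℚ.- P (suc i)) ℚ.- (P i ℚ.- P (i ∸ k)) ≡ 0ℚ
        equation = subst
          (λ i → (P (suc (i + k)) ℚ.- P (suc i)) ℚ.- (P i ℚ.- P (i ∸ k)) ≡ 0ℚ)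
          (toℕ-fromℕ< i<n)
          (trans (sym (A*v k v (fromℕ< i<n))) (Av≗0 (fromℕ< i<n)))

      T-recurrence : ∀ i → T (suc (i + k)) ≡ (T i ℚ.- T (i ∸ k)) ℚ.+ T (suc i)
      T-recurrence i = begin
        T (suc (i + k))
          ≡⟨ solve 2 (λ x y → x := (x :- y) :+ y) refl (T (suc (i + k))) (T (suc i)) ⟩
        (T (suc (i + k)) ℚ.- T (suc i)) ℚ.+ T (suc i)
          ≡⟨ cong (ℚ._+ T (suc i)) (trans (partialSum-after periodic refl i) (sym (partialSum-before periodic refl i))) ⟩
        (T i ℚ.- T (i ∸ k)) ℚ.+ T (suc i)  ∎
        where
        open ≡-Reasoning
        open +-*-Solver

      -- Up to k both sides are g by construction. Beyond k both satisfy the equation of row i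
      -- solved for its largest index `suc (i + k)`; for `P` this is available while i < n, that is,
      -- up to n + k.
      P≡T : ∀ p → p ≤ n + k → P p ≡ T p
      P≡T = <-rec (λ p → p ≤ n + k → P p ≡ T p) step
        where
        step : ∀ p → (∀ {q} → q < p → q ≤ n + k → P q ≡ T q) → p ≤ n + k → P p ≡ T p
        step p rec p≤n+k with p ≤? k
        ... | yes p≤k = trans (cong P (sym (m≤n⇒m%n≡m p≤k))) (sym (partialSum-initial periodic refl p≤k))
        ... | no  p≰k = subst (λ p → P p ≡ T p) p≡ (begin
            P (suc (i + k))                    ≡⟨ P-recurrence i (+-cancelʳ-≤ k (suc i) n (subst (_≤ n + k) (sym p≡) p≤n+k)) ⟩
            (P i ℚ.- P (i ∸ k)) ℚ.+ P (suc i)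
              ≡⟨ cong₂ ℚ._+_ (cong₂ ℚ._-_ (P≡T< i<p) (P≡T< (≤-<-trans (m∸n≤m i k) i<p))) (P≡T< 1+i<p) ⟩
            (T i ℚ.- T (i ∸ k)) ℚ.+ T (suc i)  ≡⟨ T-recurrence i ⟨
            T (suc (i + k))                    ∎)
          where
          open ≡-Reasoning
          i = p ∸ suc k
          p≡ : suc (i + k) ≡ p
          p≡ = trans (sym (+-suc i k)) (m∸n+n≡m (≰⇒> p≰k))
          P≡T< : ∀ {q} → q < p → P q ≡ T q
          P≡T< q<p = rec q<p (≤-trans (<⇒≤ q<p) p≤n+k)
          -- Here k ≥ 1 makes every index on the right of the recurrence smaller than p.
          1+i<p : suc i < p
          1+i<p = subst (suc i <_) p≡ (s≤s (m<m+n i (n≢0⇒n>0 (≢-nonZero⁻¹ k))))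
          i<p : i < p
          i<p = <-trans (n<1+n i) 1+i<p

      extend≡ : ∀ {p} → p < n + k → extend v p ≡ kernelSeq g p
      extend≡ {p} p<n+k = begin
        extend v p                     ≡⟨ solve 2 (λ x y → y := (x :+ y) :- x) refl (P p) (extend v p) ⟩
        P (suc p) ℚ.- P p              ≡⟨ cong₂ ℚ._-_ (P≡T (suc p) p<n+k) (P≡T p (<⇒≤ p<n+k)) ⟩
        T (suc p) ℚ.- T p              ≡⟨ solve 2 (λ x y → y := (x :+ y) :- x) refl (T p) (kernelSeq g p) ⟨
        kernelSeq g p                  ∎
        where
        open ≡-Reasoning
        open +-*-Solver

      closes : Closes n g
      closes r r<k = p-q≡0⇒p≡q _ _
        (trans (sym (extend≡ (+-monoʳ-< n r<k))) (extend-≥ v (m≤m+n n r)))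

      v≗ : v ≗ kernelSeq g ∘ toℕ
      v≗ i = trans (sym (extend-toℕ v i)) (extend≡ (<-≤-trans (toℕ<n i) (m≤m+n n k)))

  -- Reduction of the closing conditions modulo k² + k.

  [m+kn]/n≡m/n+k : ∀ m k n .{{_ : NonZero n}} → (m + k * n) / n ≡ m / n + k
  [m+kn]/n≡m/n+k m k n = trans (+-distrib-/-∣ʳ m (n∣m*n k)) (cong (m / n +_) (m*n/n≡m k n))

  periodic-* : ∀ {m g} → Periodic m g → ∀ z i → g (i + z * m) ≡ g i
  periodic-* {m} {g} periodic zero    i = cong g (+-identityʳ i)
  periodic-* {m} {g} periodic (suc z) i = begin
    g (i + (m + z * m))  ≡⟨ cong g (+-assoc i m (z * m)) ⟨
    g (i + m + z * m)    ≡⟨ periodic-* periodic z (i + m) ⟩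
    g (i + m)            ≡⟨ periodic i ⟩
    g i                  ∎
    where
    open ≡-Reasoning

  module _ (k : ℕ) .{{_ : NonZero k}} where

    -- Modulo k + 1 this is the argument `suc (n + r + (n + r) / k)` of the closing condition for n
    -- = (d - 1)k + s + d: dropping (d - 1)k lowers the quotient by d - 1.
    target : ℕ → ℕ → ℕ → ℕ
    target s d r = suc (s + d + r + (s + d + r) / k)

    -- Closes for n ≡ (d−1)k + s + d modulo k² + k, with the arguments of g reduced modulo k + 1.
    Cycles : ℕ → ℕ → (ℕ → ℚ) → Set
    Cycles s d g = ∀ r → r < k → g (target s d r) ≡ g (suc (s + r))

    -- The congruence n ≡ (d - 1)k + s + d is stated without subtraction: k moves to the left since
    -- d may be 0, and x, y allow either side to be the larger.
    module _ {g : ℕ → ℚ} (periodic : Periodic (suc k) g) {n s d x y : ℕ}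
      (n≡ : n + k + x * (k * k + k) ≡ d * k + s + d + y * (k * k + k)) where

      private
        congruent : ∀ {i j} u v → i + u * suc k ≡ j + v * suc k → g i ≡ g j
        congruent {i} {j} u v eq = trans (sym (periodic-* periodic u i))
          (trans (cong g eq) (periodic-* periodic v j))

        -- Modulo k + 1, adding 1 to `n≡` leaves n on the left and s + 1 on the right, because k +
        -- 1, dk + d and k² + k vanish.
        source≡ : ∀ r → g (n + r) ≡ g (suc (s + r))
        source≡ r = congruent (suc (x * k)) (d + y * k)
          (trans (lhs n r k x) (trans (cong (λ t → suc (t + r)) n≡) (rhs s r d y k)))
          where
          lhs : ∀ n r k x → n + r + suc (x * k) * suc k ≡ suc (n + k + x * (k * k + k) + r)
          lhs = solve-∀
          rhs : ∀ s r d y k → suc (d * k + s + d + y * (k * k + k) + r) ≡ suc (s + r) + (d + y * k) * suc k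
          rhs = solve-∀

        -- Since k² + k = (k + 1)k, shifts by it change the quotient by multiples of the period k +
        -- 1.
        quotient≡ : ∀ r → (n + r) / k + suc (x * suc k) ≡ (s + d + r) / k + (d + y * suc k)
        quotient≡ r = begin
          (n + r) / k + suc (x * suc k)                ≡⟨ [m+kn]/n≡m/n+k (n + r) (suc (x * suc k)) k ⟨
          (n + r + suc (x * suc k) * k) / k            ≡⟨ cong (_/ k) (lhs n r k x) ⟩
          (n + k + x * (k * k + k) + r) / k            ≡⟨ cong (λ t → (t + r) / k) n≡ ⟩
          (d * k + s + d + y * (k * k + k) + r) / k    ≡⟨ cong (_/ k) (rhs s r d y k) ⟩
          (s + d + r + (d + y * suc k) * k) / k        ≡⟨ [m+kn]/n≡m/n+k (s + d + r) (d + y * suc k) k ⟩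
          (s + d + r) / k + (d + y * suc k)            ∎
          where
          open ≡-Reasoning
          lhs : ∀ n r k x → n + r + suc (x * suc k) * k ≡ n + k + x * (k * k + k) + r
          lhs = solve-∀
          rhs : ∀ s r d y k → d * k + s + d + y * (k * k + k) + r ≡ s + d + r + (d + y * suc k) * k
          rhs = solve-∀

        target≡ : ∀ r → g (suc (n + r + (n + r) / k)) ≡ g (target s d r)
        target≡ r = congruent (suc (x * k + x)) (d + y * k + y)
          (trans (lhs n r k x ((n + r) / k))
            (trans (cong₂ (λ t q → suc (t + r + q)) n≡ (quotient≡ r))
              (rhs s r d y k ((s + d + r) / k))))
          where
          lhs : ∀ n r k x q → suc (n + r + q) + suc (x * k + x) * suc k ≡
            suc (n + k + x * (k * k + k) + r + (q + suc (x * suc k)))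
          lhs = solve-∀
          rhs : ∀ s r d y k q → suc (d * k + s + d + y * (k * k + k) + r + (q + (d + y * suc k))) ≡
            suc (s + d + r + q) + (d + y * k + y) * suc k
          rhs = solve-∀

      closes⇒cycles : Closes k n g → Cycles s d g
      closes⇒cycles closes r r<k = trans (sym (target≡ r)) (trans (closes r r<k) (source≡ r))

      cycles⇒closes : Cycles s d g → Closes k n g
      cycles⇒closes cycles r r<k = trans (target≡ r) (trans (cycles r r<k) (sym (source≡ r)))

    module _ {g : ℕ → ℚ} (periodic : Periodic (suc k) g) (s d r : ℕ) where

      target-unwrapped : s + d + r < k → g (target s d r) ≡ g (suc (s + d + r))
      target-unwrapped <k = cong (g ∘ suc) (trans (cong (s + d + r +_) (m<n⇒m/n≡0 <k)) (+-identityʳ _))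

      -- Each k taken off s + d + r also takes 1 off the quotient, hence a whole period off the
      -- argument. The target therefore reduces to one of 1, ..., k.
      target-wrapped : ∀ q z → z < k → s + d + r ≡ z + q * k → g (target s d r) ≡ g (suc z)
      target-wrapped q z z<k eq = begin
        g (suc (s + d + r + (s + d + r) / k))            ≡⟨ cong (λ t → g (suc (t + t / k))) eq ⟩
        g (suc (z + q * k + (z + q * k) / k))            ≡⟨ cong (λ t → g (suc (z + q * k + t))) quotient ⟩
        g (suc (z + q * k + q))                          ≡⟨ cong g (arith z q k) ⟩
        g (suc z + q * suc k)                            ≡⟨ periodic-* periodic q (suc z) ⟩
        g (suc z)                                        ∎
        where
        open ≡-Reasoning
        quotient : (z + q * k) / k ≡ q
        quotient = trans ([m+kn]/n≡m/n+k z q k) (cong (_+ q) (m<n⇒m/n≡0 z<k))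
        arith : ∀ z q k → suc (z + q * k + q) ≡ suc z + q * suc k
        arith = solve-∀

  -- The labelling of the cycles.

  -- Total version of _%_: the value at divisor 0 is junk.
  rem : ℕ → ℕ → ℕ
  rem x zero    = 0
  rem x (suc d) = x % suc d

  rem-+ : ∀ x d → rem (x + d) d ≡ rem x d
  rem-+ x zero    = refl
  rem-+ x (suc d) = [m+n]%n≡m%n x (suc d)

  rem-+* : ∀ x j d → rem (x + j * d) d ≡ rem x d
  rem-+* x j zero    = refl
  rem-+* x j (suc d) = [m+kn]%n≡m%n x j (suc d)

  rem-small : ∀ {x d} → x < d → rem x d ≡ x
  rem-small {x} {suc d} (s≤s x≤d) = m≤n⇒m%n≡m x≤d

  module _ (a d : ℕ) where

    private
      m = suc d
      s = a * suc d

    -- The labels name the cycles on 0, …, k = a(d+1) + cd: up to a(d+1) the cycles advance by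
    -- d + 1, beyond it by d.  Label 0 is the cycle through 0, where g vanishes, and t = 1, …, d
    -- represents the cycle with label t.
    label : ℕ → ℕ
    label i with i ≤? s
    ... | yes _ = i % m
    ... | no  _ = suc (rem (i ∸ suc s) d)

    label-≤ : ∀ {i} → i ≤ s → label i ≡ i % m
    label-≤ {i} i≤s with i ≤? s
    ... | yes _   = refl
    ... | no  i≰s = contradiction i≤s i≰s

    label-> : ∀ x → label (suc (s + x)) ≡ suc (rem x d)
    label-> x with suc (s + x) ≤? s
    ... | yes <s = contradiction <s (<⇒≱ (s≤s (m≤m+n s x)))
    ... | no  _  = cong (λ y → suc (rem y d)) (m+n∸m≡n s x)

    block-< : ∀ {j t} → j < a → t ≤ d → t + j * m < s
    block-< {j} {t} j<a t≤d = ≤-trans (+-monoˡ-≤ (j * m) (s≤s t≤d)) (*-monoˡ-≤ m j<a)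

    -- For j = a and t ≥ 1 the position lies beyond a(d + 1), at offset t - 1 < d, and the `suc` in
    -- `label` makes the two rules agree there.
    label-block : ∀ {j t} → j ≤ a → t ≤ d → label (t + j * m) ≡ t
    label-block {j} {t} j≤a t≤d with m≤n⇒m<n∨m≡n j≤a
    label-block {j} {t} j≤a t≤d | inj₁ j<a = begin
      label (t + j * m)  ≡⟨ label-≤ (<⇒≤ (block-< j<a t≤d)) ⟩
      (t + j * m) % m    ≡⟨ [m+kn]%n≡m%n t j m ⟩
      t % m              ≡⟨ m≤n⇒m%n≡m t≤d ⟩
      t                  ∎
      where
      open ≡-Reasoning
    label-block {j} {zero} j≤a t≤d  | inj₂ refl = trans (label-≤ ≤-refl) (m*n%n≡0 a m)
    label-block {j} {suc e} j≤a e<d | inj₂ refl = begin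
      label (suc (e + s))  ≡⟨ cong (label ∘ suc) (+-comm e s) ⟩
      label (suc (s + e))  ≡⟨ label-> e ⟩
      suc (rem e d)        ≡⟨ cong suc (rem-small e<d) ⟩
      suc e                ∎
      where
      open ≡-Reasoning

    label-small : ∀ {t} → t ≤ d → label t ≡ t
    label-small {t} t≤d = trans (cong label (sym (+-identityʳ t))) (label-block {0} z≤n t≤d)

    -- A step of d + 1 from below a(d + 1) may land beyond it, but then still in block a, which
    -- `label-block` covers.
    label-+ : ∀ {i} → i < s → label (i + m) ≡ label i
    label-+ {i} i<s = begin
      label (i + m)                      ≡⟨ cong (λ x → label (x + m)) (m≡m%n+[m/n]*n i m) ⟩
      label (i % m + i / m * m + m)      ≡⟨ cong label (arith (i % m) (i / m) m) ⟩
      label (i % m + suc (i / m) * m)    ≡⟨ label-block (m<n*o⇒m/o<n i<s) (≤-pred (m%n<n i m)) ⟩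
      i % m                              ≡⟨ label-≤ (<⇒≤ i<s) ⟨
      label i                            ∎
      where
      open ≡-Reasoning
      arith : ∀ t j m → t + j * m + m ≡ t + suc j * m
      arith = solve-∀

  -- Sequences constant on labels satisfy the cycle conditions.

  module _ (k a c d : ℕ) .{{_ : NonZero k}} (k≡ : k ≡ a * suc d + c * d) (d≤k : d ≤ k) where

    private
      m = suc d
      s = a * suc d
      lab = label a d

    s≤k : s ≤ k
    s≤k = ≤-trans (m≤m+n s (c * d)) (≤-reflexive (sym k≡))

    label≤d : ∀ {i} → i ≤ k → lab i ≤ d
    label≤d {i} i≤k with i ≤? s
    ... | yes _ = ≤-pred (m%n<n i m)
    ... | no  i≰s = rem< d (≤-trans (≰⇒> i≰s) (≤-trans i≤k (≤-reflexive k≡)))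
      where
      rem< : ∀ d {x} → s < s + c * d → suc (rem x d) ≤ d
      rem< (suc d) {x} _ = m%n<n x (suc d)
      -- For d = 0 nothing lies beyond a(d + 1), so the junk value of `rem` does not occur.
      rem< zero s<s+c*0 = contradiction s<s+c*0
        (≤⇒≯ (≤-reflexive (trans (cong (s +_) (*-zeroʳ c)) (+-identityʳ s))))

    module _ (w : ℕ → ℚ) where

      labelled : ℕ → ℚ
      labelled i = w (lab (i % suc k))

      labelled-periodic : Periodic (suc k) labelled
      labelled-periodic i = cong (w ∘ lab) ([m+n]%n≡m%n i (suc k))

      labelled-≤ : ∀ {i} → i ≤ k → labelled i ≡ w (lab i)
      labelled-≤ i≤k = cong (w ∘ lab) (m≤n⇒m%n≡m i≤k)

      -- For r < cd the source `suc (s + r)` lies beyond s and moves by d; otherwise it is y = r -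
      -- cd modulo k + 1 and moves by d + 1. Each case checks that the label survives, including
      -- wraps past k.
      labelled-cycles : Cycles k s d labelled
      labelled-cycles r r<k with r <? c * d
      labelled-cycles r r<k | yes r<cd with r + d <? c * d
      ... | yes r+d<cd = begin
        labelled (target k s d r)    ≡⟨ target-unwrapped k labelled-periodic s d r (subst (_< k) (sym assoc) s+[r+d]<k) ⟩
        labelled (suc (s + d + r))   ≡⟨ cong (labelled ∘ suc) assoc ⟩
        labelled (suc (s + (r + d))) ≡⟨ labelled-≤ s+[r+d]<k ⟩
        w (lab (suc (s + (r + d))))  ≡⟨ cong w (label-> a d (r + d)) ⟩
        w (suc (rem (r + d) d))      ≡⟨ cong (w ∘ suc) (rem-+ r d) ⟩
        w (suc (rem r d))            ≡⟨ cong w (label-> a d r) ⟨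
        w (lab (suc (s + r)))        ≡⟨ labelled-≤ (≤-trans (s≤s (+-monoʳ-≤ s (m≤m+n r d))) s+[r+d]<k) ⟨
        labelled (suc (s + r))       ∎
        where
        open ≡-Reasoning
        assoc : s + d + r ≡ s + (r + d)
        assoc = trans (+-assoc s d r) (cong (s +_) (+-comm d r))
        s+[r+d]<k : s + (r + d) < k
        s+[r+d]<k = subst (s + (r + d) <_) (sym k≡) (+-monoʳ-< s r+d<cd)
      -- The step passes k and lands on e + 1 with e = r + d - cd < d, so e is the remainder of r
      -- modulo d.
      ... | no r+d≮cd = begin
        labelled (target k s d r)    ≡⟨ target-wrapped k labelled-periodic s d r 1 e (<-≤-trans e<d d≤k) position ⟩
        labelled (suc e)             ≡⟨ labelled-≤ (≤-trans e<d d≤k) ⟩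
        w (lab (suc e))              ≡⟨ cong w (label-small a d e<d) ⟩
        w (suc e)                    ≡⟨ cong (w ∘ suc) rem≡ ⟨
        w (suc (rem r d))            ≡⟨ cong w (label-> a d r) ⟨
        w (lab (suc (s + r)))        ≡⟨ labelled-≤ (subst (suc (s + r) ≤_) (sym k≡) (+-monoʳ-< s r<cd)) ⟨
        labelled (suc (s + r))       ∎
        where
        open ≡-Reasoning
        e = r + d ∸ c * d
        e+cd : e + c * d ≡ r + d
        e+cd = m∸n+n≡m (≮⇒≥ r+d≮cd)
        e<d : e < d
        e<d = +-cancelʳ-< (c * d) e d
          (subst₂ _<_ (sym e+cd) (+-comm (c * d) d) (+-monoˡ-< d r<cd))
        arith : ∀ s d r e cd → r + d ≡ e + cd → s + d + r ≡ e + 1 * (s + cd)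
        arith s d r e cd eq = trans (lhs s d r) (trans (cong (s +_) eq) (rhs s e cd))
          where
          lhs : ∀ s d r → s + d + r ≡ s + (r + d)
          lhs = solve-∀
          rhs : ∀ s e cd → s + (e + cd) ≡ e + 1 * (s + cd)
          rhs = solve-∀
        position : s + d + r ≡ e + 1 * k
        position = trans (arith s d r e (c * d) (sym e+cd)) (cong (λ k → e + 1 * k) (sym k≡))
        rem≡ : rem r d ≡ e
        rem≡ = begin
          rem r d            ≡⟨ rem-+ r d ⟨
          rem (r + d) d      ≡⟨ cong (λ x → rem x d) e+cd ⟨
          rem (e + c * d) d  ≡⟨ rem-+* e c d ⟩
          rem e d            ≡⟨ rem-small e<d ⟩
          e                  ∎
      labelled-cycles r r<k | no r≮cd = trans upper (sym lower)
        where
        y = r ∸ c * d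
        y+cd : y + c * d ≡ r
        y+cd = m∸n+n≡m (≮⇒≥ r≮cd)
        y<s : y < s
        y<s = +-cancelʳ-< (c * d) y s (subst₂ _<_ (sym y+cd) k≡ r<k)
        y<k = <-≤-trans y<s s≤k

        lower : labelled (suc (s + r)) ≡ w (lab y)
        lower = begin
          labelled (suc (s + r))            ≡⟨ cong (λ r → labelled (suc (s + r))) y+cd ⟨
          labelled (suc (s + (y + c * d)))  ≡⟨ cong labelled (arith s y (c * d)) ⟩
          labelled (y + suc (s + c * d))    ≡⟨ cong (λ k → labelled (y + suc k)) k≡ ⟨
          labelled (y + suc k)              ≡⟨ labelled-periodic y ⟩
          labelled y                        ≡⟨ labelled-≤ (<⇒≤ y<k) ⟩
          w (lab y)                         ∎
          where
          open ≡-Reasoning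
          arith : ∀ s y x → suc (s + (y + x)) ≡ y + suc (s + x)
          arith = solve-∀

        position : s + d + r ≡ y + d + 1 * k
        position = begin
          s + d + r                   ≡⟨ cong (s + d +_) y+cd ⟨
          s + d + (y + c * d)         ≡⟨ arith s d y (c * d) ⟩
          y + d + 1 * (s + c * d)     ≡⟨ cong (λ k → y + d + 1 * k) k≡ ⟨
          y + d + 1 * k               ∎
          where
          open ≡-Reasoning
          arith : ∀ s d y x → s + d + (y + x) ≡ y + d + 1 * (s + x)
          arith = solve-∀

        upper : labelled (target k s d r) ≡ w (lab y)
        upper with y + d <? k
        ... | yes y+d<k = begin
          labelled (target k s d r)  ≡⟨ target-wrapped k labelled-periodic s d r 1 (y + d) y+d<k position ⟩
          labelled (suc (y + d))     ≡⟨ labelled-≤ y+d<k ⟩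
          w (lab (suc (y + d)))      ≡⟨ cong (w ∘ lab) (+-suc y d) ⟨
          w (lab (y + m))            ≡⟨ cong w (label-+ a d y<s) ⟩
          w (lab y)                  ∎
          where
          open ≡-Reasoning
        -- Two wraps occur. Comparing y + d + 1 = z + 1 + cd + s with the block form of y places y
        -- in the last block before s. Its offset t = z + 1 + cd is at most d, which forces c = 0.
        ... | no y+d≮k = begin
          labelled (target k s d r)  ≡⟨ target-wrapped k labelled-periodic s d r 2 z z<k position₂ ⟩
          labelled (suc z)           ≡⟨ labelled-≤ z<k ⟩
          w (lab (suc z))            ≡⟨ cong (w ∘ lab) t≡ ⟨
          w (lab t)                  ≡⟨ cong w (label-small a d t≤d) ⟩
          w t                        ≡⟨ cong w (label-≤ a d (<⇒≤ y<s)) ⟨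
          w (lab y)                  ∎
          where
          open ≡-Reasoning
          z = y + d ∸ k
          z+k : z + k ≡ y + d
          z+k = m∸n+n≡m (≮⇒≥ y+d≮k)
          z<d : z < d
          z<d = +-cancelʳ-< k z d (subst₂ _<_ (sym z+k) (+-comm k d) (+-monoˡ-< d y<k))
          z<k = <-≤-trans z<d d≤k
          position₂ : s + d + r ≡ z + 2 * k
          position₂ = trans position (trans (cong (_+ 1 * k) (sym z+k)) (arith z k))
            where
            arith : ∀ z k → z + k + 1 * k ≡ z + 2 * k
            arith = solve-∀
          t = y % m
          t≤d = ≤-pred (m%n<n y m)
          j<a : y / m < a
          j<a = m<n*o⇒m/o<n y<s
          c≡0 : ∀ c → c * d < d → c ≡ 0
          c≡0 zero    _  = refl
          c≡0 (suc c) lt = contradiction lt (≤⇒≯ (m≤m+n d (c * d)))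
          t+ : t + suc (y / m) * m ≡ suc z + c * d + s
          t+ = begin
            t + suc (y / m) * m  ≡⟨ arith₁ t (y / m) d ⟩
            suc (t + y / m * m + d)  ≡⟨ cong (λ y → suc (y + d)) (m≡m%n+[m/n]*n y m) ⟨
            suc (y + d)              ≡⟨ cong suc z+k ⟨
            suc (z + k)              ≡⟨ cong (λ k → suc (z + k)) k≡ ⟩
            suc (z + (s + c * d))    ≡⟨ arith₂ z s (c * d) ⟩
            suc z + c * d + s        ∎
            where
            arith₁ : ∀ t j d → t + suc j * suc d ≡ suc (t + j * suc d + d)
            arith₁ = solve-∀
            arith₂ : ∀ z s x → suc (z + (s + x)) ≡ suc z + x + s
            arith₂ = solve-∀
          1+j≡a : suc (y / m) ≡ a
          1+j≡a with m≤n⇒m<n∨m≡n j<a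
          ... | inj₂ eq = eq
          ... | inj₁ lt = contradiction
            (subst (_< s) t+ (block-< a d lt t≤d)) (≤⇒≯ (m≤n+m s (suc z + c * d)))
          t≡+ : t ≡ suc z + c * d
          t≡+ = +-cancelʳ-≡ s t (suc z + c * d) (trans (cong (λ j → t + j * m) (sym 1+j≡a)) t+)
          t≡ : t ≡ suc z
          t≡ = trans t≡+ (trans (cong (λ c → suc z + c * d)
            (c≡0 c (≤-trans (s≤s (m≤n+m (c * d) z)) (subst (_≤ d) t≡+ t≤d)))) (+-identityʳ (suc z)))

    -- Sequences satisfying the cycle conditions are constant on labels.

    module _ {g : ℕ → ℚ} (periodic : Periodic (suc k) g) (cycles : Cycles k s d g) where

      -- The condition at r = cd + y has source y + (k + 1); since y + d < k, its target wraps once,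
      -- to y + d + 1.
      cycles-block : ∀ {y} → y < s → y + m ≤ k → g (y + m) ≡ g y
      cycles-block {y} y<s y+m≤k = begin
        g (y + m)                  ≡⟨ cong g (+-suc y d) ⟩
        g (suc (y + d))            ≡⟨ target-wrapped k periodic s d r 1 (y + d) (subst (_≤ k) (+-suc y d) y+m≤k) position ⟨
        g (target k s d r)         ≡⟨ cycles r (subst₂ _<_ (+-comm y (c * d)) (sym k≡) (+-monoˡ-< (c * d) y<s)) ⟩
        g (suc (s + (c * d + y)))  ≡⟨ cong g (arith s (c * d) y) ⟩
        g (y + suc (s + c * d))    ≡⟨ cong (λ k → g (y + suc k)) k≡ ⟨
        g (y + suc k)              ≡⟨ periodic y ⟩
        g y                        ∎
        where
        open ≡-Reasoning
        r = c * d + y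
        arith : ∀ s x y → suc (s + (x + y)) ≡ y + suc (s + x)
        arith = solve-∀
        arith₂ : ∀ s d x y → s + d + (x + y) ≡ y + d + 1 * (s + x)
        arith₂ = solve-∀
        position : s + d + r ≡ y + d + 1 * k
        position = trans (arith₂ s d (c * d) y) (cong (λ k → y + d + 1 * k) (sym k≡))

      cycles-blocks : ∀ {t} j → j ≤ a → t ≤ d → t + j * m ≤ k → g (t + j * m) ≡ g t
      cycles-blocks {t} zero    _   _   _  = cong g (+-identityʳ t)
      cycles-blocks {t} (suc j) j<a t≤d ≤k = begin
        g (t + suc j * m)  ≡⟨ cong g (arith t j m) ⟩
        g (t + j * m + m)  ≡⟨ cycles-block (block-< a d j<a t≤d) ≤k′ ⟩
        g (t + j * m)      ≡⟨ cycles-blocks j (<⇒≤ j<a) t≤d (≤-trans (m≤m+n _ m) ≤k′) ⟩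
        g t                ∎
        where
        open ≡-Reasoning
        arith : ∀ t j m → t + suc j * m ≡ t + j * m + m
        arith = solve-∀
        ≤k′ : t + j * m + m ≤ k
        ≤k′ = subst (_≤ k) (arith t j m) ≤k

      -- As long as the target stays at most k, the condition at r = x + jd is a plain step by d.
      cycles-tail : ∀ x j → x + j * d < c * d → g (suc (s + (x + j * d))) ≡ g (suc (s + x))
      cycles-tail x zero    _  = cong (λ x → g (suc (s + x))) (+-identityʳ x)
      cycles-tail x (suc j) lt = begin
        g (suc (s + (x + (d + j * d))))  ≡⟨ cong (g ∘ suc) (arith s x d (j * d)) ⟩
        g (suc (s + d + r))              ≡⟨ target-unwrapped k periodic s d r <k ⟨
        g (target k s d r)               ≡⟨ cycles r (≤-<-trans (m≤n+m r (s + d)) <k) ⟩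
        g (suc (s + r))                  ≡⟨ cycles-tail x j (≤-<-trans (+-monoʳ-≤ x (m≤n+m (j * d) d)) lt) ⟩
        g (suc (s + x))                  ∎
        where
        open ≡-Reasoning
        r = x + j * d
        arith : ∀ s x d y → s + (x + (d + y)) ≡ s + d + (x + y)
        arith = solve-∀
        <k : s + d + r < k
        <k = subst₂ _<_ (arith s x d (j * d)) (sym k≡) (+-monoʳ-< s lt)

      -- Up to s, steps of d + 1 lead back to the residue. Beyond s, steps of d lead back to an
      -- offset below d, which lies in block a, and steps of d + 1 finish the descent.
      cycles-label : ∀ {i} → i ≤ k → g i ≡ g (lab i)
      cycles-label {i} i≤k with i ≤? s
      ... | yes i≤s = begin
        g i                       ≡⟨ cong g i≡ ⟩
        g (i % m + i / m * m)     ≡⟨ cycles-blocks (i / m) j≤a (≤-pred (m%n<n i m)) (subst (_≤ k) i≡ i≤k) ⟩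
        g (i % m)                 ∎
        where
        open ≡-Reasoning
        i≡ = m≡m%n+[m/n]*n i m
        j≤a : i / m ≤ a
        j≤a = subst (i / m ≤_) (m*n/n≡m a m) (/-monoˡ-≤ m i≤s)
      ... | no i≰s = trans (cong g (sym i≡)) (tail d refl)
        where
        open ≡-Reasoning
        x = i ∸ suc s
        i≡ : suc (s + x) ≡ i
        i≡ = m+[n∸m]≡n (≰⇒> i≰s)
        x<cd : x < c * d
        x<cd = +-cancelˡ-< s x (c * d) (subst₂ _≤_ (sym i≡) k≡ i≤k)
        -- Splitting on d through an equation lets `rem` reduce; d = 0 contradicts x < cd.
        tail : ∀ d′ → d ≡ d′ → g (suc (s + x)) ≡ g (suc (rem x d))
        tail zero     refl = contradiction (subst (x <_) (*-zeroʳ c) x<cd) λ ()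
        tail (suc d′) refl = begin
          g (suc (s + x))                    ≡⟨ cong (λ x → g (suc (s + x))) x≡ ⟩
          g (suc (s + (x % d + x / d * d)))  ≡⟨ cycles-tail (x % d) (x / d) (subst (_< c * d) x≡ x<cd) ⟩
          g (suc (s + x % d))                ≡⟨ cong (g ∘ suc) (+-comm s (x % d)) ⟩
          g (suc (x % d) + s)                ≡⟨ cycles-blocks a ≤-refl (m%n<n x d) bound ⟩
          g (suc (x % d))                    ∎
          where
          x≡ = m≡m%n+[m/n]*n x d
          bound : suc (x % d) + s ≤ k
          bound = subst₂ _≤_ (cong suc (+-comm s (x % d))) (sym k≡)
            (+-monoʳ-< s (≤-<-trans (m%n≤m x d) x<cd))

  -- The basis of the kernel.

  -- Basis vector l belongs to the cycle with label l + 1; label 0 gets the value 0, as g 0 = 0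
  -- requires.
  unit : ∀ {d} → Fin d → ℕ → ℚ
  unit l x = if x ≡ᵇ suc (toℕ l) then 1ℚ else 0ℚ

  combine : ∀ {d} → Vector ℚ d → ℕ → ℚ
  combine c x = ∑ (λ l → c l ℚ.* unit l x)

  combine-zero : ∀ {d} (c : Vector ℚ d) → combine c 0 ≡ 0ℚ
  combine-zero c = ∑-zero (λ l → ℚ.*-zeroʳ (c l))

  combine-suc : ∀ {d} (c : Vector ℚ d) x → combine c (suc x) ≡ extend c x
  combine-suc {zero}  c x       = refl
  combine-suc {suc d} c zero    = trans
    (cong₂ ℚ._+_ (ℚ.*-identityʳ (c Fin.zero)) (∑-zero (λ l → ℚ.*-zeroʳ (c (Fin.suc l)))))
    (ℚ.+-identityʳ (c Fin.zero))
  combine-suc {suc d} c (suc x) = trans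
    (cong₂ ℚ._+_ (ℚ.*-zeroʳ (c Fin.zero)) (combine-suc (c ∘ Fin.suc) x))
    (ℚ.+-identityˡ (extend (c ∘ Fin.suc) x))

  module _ (k a c d : ℕ) .{{_ : NonZero k}} (k≡ : k ≡ a * suc d + c * d) (d≤k : d ≤ k)
    {n x y : ℕ} (k<n : k < n)
    (n≡ : n + k + x * (k * k + k) ≡ d * k + a * suc d + d + y * (k * k + k)) where

    private
      generator : (ℕ → ℚ) → ℕ → ℚ
      generator = labelled k a c d k≡ d≤k

      generator-periodic : ∀ w → Periodic (suc k) (generator w)
      generator-periodic = labelled-periodic k a c d k≡ d≤k

      generator-zero : ∀ w → generator w 0 ≡ w 0
      generator-zero w = cong w (label-small a d z≤n)

      kernelBasis : Vector (Vector ℚ n) d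
      kernelBasis l = kernelSeq k (generator (unit l)) ∘ toℕ

      -- Both `kernelSeq` and `labelled` are linear in the function of labels, and the combined
      -- generators unfold to `generator (combine b)`.
      linearCombination≡ : ∀ b → linearCombination b kernelBasis ≗ kernelSeq k (generator (combine b)) ∘ toℕ
      linearCombination≡ b i = trans
        (∑-cong (λ l → *-distribˡ-- (b l) (generator (unit l) (suc (toℕ i + toℕ i / k))) (generator (unit l) (toℕ i))))
        (∑-distrib-- (λ l → b l ℚ.* generator (unit l) (suc (toℕ i + toℕ i / k)))
                     (λ l → b l ℚ.* generator (unit l) (toℕ i)))

      -- The first k entries lie inside the vector because k < n. Their partial sums recover g (l +
      -- 1), which is the coefficient b l.
      independent : LinearlyIndependent kernelBasis
      independent b combination≗0 l = begin
        b l                         ≡⟨ extend-toℕ b l ⟨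
        extend b (toℕ l)            ≡⟨ combine-suc b (toℕ l) ⟨
        combine b (suc (toℕ l))     ≡⟨ cong (combine b) (label-small a d (toℕ<n l)) ⟨
        combine b (label a d (suc (toℕ l)))
                                    ≡⟨ labelled-≤ k a c d k≡ d≤k (combine b) l<k ⟨
        g (suc (toℕ l))             ≡⟨ partialSum-initial k (generator-periodic (combine b)) g0≡0 l<k ⟨
        partialSum (kernelSeq k g) (suc (toℕ l))
                                    ≡⟨ partialSum-stable (kernelSeq k g) {0} z≤n (λ i _ i≤l → seq≡0 (<-≤-trans i≤l l<k)) ⟩
        0ℚ                          ∎
        where
        open ≡-Reasoning
        g = generator (combine b)
        l<k = ≤-trans (toℕ<n l) d≤k
        g0≡0 = trans (generator-zero (combine b)) (combine-zero b)
        seq≡0 : ∀ {i} → i < k → kernelSeq k g i ≡ 0ℚ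
        seq≡0 {i} i<k = subst (λ i → kernelSeq k g i ≡ 0ℚ) (toℕ-fromℕ< i<n)
          (trans (sym (linearCombination≡ b (fromℕ< i<n))) (combination≗0 (fromℕ< i<n)))
          where i<n = <-trans i<k k<n

      module _ {g : ℕ → ℚ} (periodic : Periodic (suc k) g) (g0≡0 : g 0 ≡ 0ℚ) (closes : Closes k n g) where

        -- Positions 1, ..., d carry the labels 1, ..., d, so the values there are the free
        -- parameters of g.
        coordinates : Vector ℚ d
        coordinates l = g (suc (toℕ l))

        combine-coordinates : ∀ t → t ≤ d → g t ≡ combine coordinates t
        combine-coordinates zero    _   = trans g0≡0 (sym (combine-zero coordinates))
        combine-coordinates (suc t) t<d = sym (trans (combine-suc coordinates t) (extend-< (g ∘ suc) t<d))

        generator-coordinates : ∀ i → g i ≡ generator (combine coordinates) i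
        generator-coordinates i = begin
          g i                               ≡⟨ cong g (m≡m%n+[m/n]*n i (suc k)) ⟩
          g (j + i / suc k * suc k)         ≡⟨ periodic-* periodic (i / suc k) j ⟩
          g j                               ≡⟨ cycles-label k a c d k≡ d≤k periodic cycles j≤k ⟩
          g (label a d j)                   ≡⟨ combine-coordinates (label a d j) (label≤d k a c d k≡ d≤k j≤k) ⟩
          combine coordinates (label a d j) ∎
          where
          open ≡-Reasoning
          j = i % suc k
          j≤k = ≤-pred (m%n<n i (suc k))
          cycles : Cycles k (a * suc d) d g
          cycles = closes⇒cycles k periodic {n} {a * suc d} {d} {x} {y} n≡ closes

      spanning : ∀ v → InKernel (A n k) v → ∃[ b ] v ≗ linearCombination b kernelBasis
      spanning v Av≗0 =
        let g , periodic , g0≡0 , closes , v≗ = inKernel⇒kernelSeq k v Av≗0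
            g≡ = generator-coordinates periodic g0≡0 closes
            b  = coordinates periodic g0≡0 closes
        in b , λ i → trans (v≗ i)
          (trans (cong₂ ℚ._-_ (g≡ (suc (toℕ i + toℕ i / k))) (g≡ (toℕ i))) (sym (linearCombination≡ b i)))

    nullity : HasNullity (A n k) d
    nullity = kernelBasis , record
      { inKernel    = λ l → kernelSeq-inKernel k (generator-periodic (unit l)) (generator-zero (unit l))
          (cycles⇒closes k (generator-periodic (unit l)) {n} {a * suc d} {d} {x} {y} n≡ (labelled-cycles k a c d k≡ d≤k (unit l)))
      ; independent = independent
      ; spanning    = spanning
      }

-- Integer congruences and the closed form of the size.

open import Data.Integer using (+_; -[1+_]; _+_; _-_; _*_; _/ℕ_)
import Data.Integer.Divisibility.Signed as ℤ
import Data.Integer.Properties as ℤ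
import Data.Integer.Tactic.RingSolver as ℤSolver
open import Data.Nat as ℕ using (ℕ; zero; suc; NonZero; _≤_; >-nonZero)
import Data.Nat.DivMod as ℕ
import Data.Nat.Properties as ℕ
import Data.Nat.Tactic.RingSolver as ℕSolver
open import Data.Product using (∃-syntax; _×_; _,_)
open import Data.Sum using (_⊎_; inj₁; inj₂)
open import Relation.Binary.PropositionalEquality
open import Relation.Nullary using (contradiction)

-- The sign of the integer quotient decides which side is larger; `suc z` comes from `-[1+ z ]`.
mod⇒multiple : ∀ {x y m} → + x ≡ + y [mod + m ] →
  (∃[ z ] x ≡ y ℕ.+ z ℕ.* m) ⊎ (∃[ z ] x ℕ.+ suc z ℕ.* m ≡ y)
mod⇒multiple {x} {y} {m} (ℤ.divides (+ z) eq) = inj₁ (z , ℤ.+-injective (begin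
  + x                      ≡⟨ recover (+ x) (+ y) ⟩
  + y + (+ x - + y)        ≡⟨ cong (λ t → + y + t) (trans eq (sym (ℤ.pos-* z m))) ⟩
  + (y ℕ.+ z ℕ.* m)        ∎))
  where
  open ≡-Reasoning
  recover : ∀ x y → x ≡ y + (x - y)
  recover = ℤSolver.solve-∀
mod⇒multiple {x} {y} {m} (ℤ.divides -[1+ z ] eq) = inj₂ (z , ℤ.+-injective (begin
  + x + + (suc z ℕ.* m)                       ≡⟨ cong (λ t → + x + t) (ℤ.pos-* (suc z) m) ⟩
  + x + + suc z * + m                         ≡⟨ recover (+ x) (+ y) (+ suc z * + m) ⟩
  + y + ((+ x - + y) + + suc z * + m)         ≡⟨ cong (λ t → + y + (t + + suc z * + m)) eq ⟩
  + y + (-[1+ z ] * + m + + suc z * + m)      ≡⟨ cong (λ t → + y + t) (ℤ.*-distribʳ-+ (+ m) -[1+ z ] (+ suc z)) ⟨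
  + y + (-[1+ z ] + + suc z) * + m            ≡⟨ cong (λ t → + y + t * + m) (ℤ.+-inverseˡ (+ suc z)) ⟩
  + y + + 0 * + m                             ≡⟨ ℤ.+-identityʳ (+ y) ⟩
  + y                                         ∎))
  where
  open ≡-Reasoning
  recover : ∀ x y t → x + t ≡ y + ((x - y) + t)
  recover = ℤSolver.solve-∀

theorem8p10 : (k a b : ℕ) .{{_ : NonZero b}} → 1 ≤ k → a ≤ b → + k ≡ + a [mod + b ] →
    ∃[ d ] (+ d ≡ (+ k - + a) /ℕ b) × (N⟨ ((+ k + + 1 + + a - + b) * (+ k - + a)) /ℕ b , k ⟩≡ d)
theorem8p10 k a b 1≤k a≤b k≡a[b] with mod⇒multiple k≡a[b]
-- This would give a = k + (z + 1)b > b, since k ≥ 1.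
... | inj₂ (z , eq) = contradiction a≤b
  (ℕ.<⇒≱ (subst (b ℕ.<_) eq (ℕ.+-mono-≤ 1≤k (ℕ.m≤m+n b (z ℕ.* b)))))
... | inj₁ (d , k≡a+db) = d , sym quotient ,
  λ n k<n n≡ → conclude n k<n (mod⇒multiple (subst (+ n ≡_[mod + (k ℕ.* k ℕ.+ k) ]) size≡ n≡))
  where
  open ≡-Reasoning
  c = b ℕ.∸ a

  instance
    k≢0 : NonZero k
    k≢0 = >-nonZero 1≤k

  k-a≡db : + k - + a ≡ + (d ℕ.* b)
  k-a≡db = begin
    + k - + a                    ≡⟨ cong (λ k → + k - + a) k≡a+db ⟩
    + a + + (d ℕ.* b) - + a      ≡⟨ cancel (+ a) (+ (d ℕ.* b)) ⟩
    + (d ℕ.* b)                  ∎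
    where
    cancel : ∀ x y → x + y - x ≡ y
    cancel = ℤSolver.solve-∀

  quotient : (+ k - + a) /ℕ b ≡ + d
  quotient = trans (cong (_/ℕ b) k-a≡db) (cong +_ (ℕ.m*n/n≡m d b))

  k≡ : k ≡ a ℕ.* suc d ℕ.+ c ℕ.* d
  k≡ = begin
    k                          ≡⟨ k≡a+db ⟩
    a ℕ.+ d ℕ.* b              ≡⟨ cong (λ b → a ℕ.+ d ℕ.* b) (ℕ.m+[n∸m]≡n a≤b) ⟨
    a ℕ.+ d ℕ.* (a ℕ.+ c)      ≡⟨ arith a d c ⟩
    a ℕ.* suc d ℕ.+ c ℕ.* d    ∎
    where
    arith : ∀ a d c → a ℕ.+ d ℕ.* (a ℕ.+ c) ≡ a ℕ.* suc d ℕ.+ c ℕ.* d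
    arith = ℕSolver.solve-∀

  d≤k : d ≤ k
  d≤k = ℕ.≤-trans (ℕ.m≤m*n d b) (ℕ.≤-trans (ℕ.m≤n+m (d ℕ.* b) a) (ℕ.≤-reflexive (sym k≡a+db)))

  -- Ensures that the subtraction in `size` is not truncated: for d = 0 both sides equal a,
  -- otherwise dk ≥ k.
  k≤ : ∀ d → k ≡ a ℕ.+ d ℕ.* b → k ≤ d ℕ.* k ℕ.+ a ℕ.* suc d ℕ.+ d
  k≤ zero    eq = ℕ.≤-reflexive (trans eq (arith a))
    where
    arith : ∀ a → a ℕ.+ 0 ≡ a ℕ.* 1 ℕ.+ 0
    arith = ℕSolver.solve-∀
  k≤ (suc d) eq = ℕ.≤-trans (ℕ.m≤m+n k (d ℕ.* k))
    (ℕ.≤-trans (ℕ.m≤m+n _ (a ℕ.* suc (suc d))) (ℕ.m≤m+n _ (suc d)))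

  -- Since bd = k - a, this is (k + 1 + a - b)d.
  size : ℕ
  size = d ℕ.* k ℕ.+ a ℕ.* suc d ℕ.+ d ℕ.∸ k

  size+k : size ℕ.+ k ≡ d ℕ.* k ℕ.+ a ℕ.* suc d ℕ.+ d
  size+k = ℕ.m∸n+n≡m (k≤ d k≡a+db)

  size≡ : ((+ k + + 1 + + a - + b) * (+ k - + a)) /ℕ b ≡ + size
  size≡ = trans (cong (_/ℕ b) product) (cong +_ (ℕ.m*n/n≡m size b))
    where
    +k≡ : + k ≡ + a + + d * + b
    +k≡ = trans (cong +_ k≡a+db) (cong (λ t → + a + t) (ℤ.pos-* d b))
    +size+k : + size + + k ≡ + d * + k + + a * (+ 1 + + d) + + d
    +size+k = trans (cong +_ size+k) (cong₂ (λ u v → u + v + + d) (ℤ.pos-* d k) (ℤ.pos-* a (suc d)))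
    +size≡ : + size ≡ + d * + k + + a * (+ 1 + + d) + + d - + k
    +size≡ = trans (recover (+ size) (+ k)) (cong (_- + k) +size+k)
      where
      recover : ∀ x y → x ≡ x + y - y
      recover = ℤSolver.solve-∀
    identity : ∀ a b d → let k = a + d * b in
      (k + + 1 + a - b) * (k - a) ≡ (d * k + a * (+ 1 + d) + d - k) * b
    identity = ℤSolver.solve-∀
    product : (+ k + + 1 + + a - + b) * (+ k - + a) ≡ + (size ℕ.* b)
    product = begin
      (+ k + + 1 + + a - + b) * (+ k - + a)
        ≡⟨ cong (λ k → (k + + 1 + + a - + b) * (k - + a)) +k≡ ⟩
      (+ a + + d * + b + + 1 + + a - + b) * (+ a + + d * + b - + a)
        ≡⟨ identity (+ a) (+ b) (+ d) ⟩
      (+ d * (+ a + + d * + b) + + a * (+ 1 + + d) + + d - (+ a + + d * + b)) * + b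
        ≡⟨ cong (λ k → (+ d * k + + a * (+ 1 + + d) + + d - k) * + b) +k≡ ⟨
      (+ d * + k + + a * (+ 1 + + d) + + d - + k) * + b
        ≡⟨ cong (_* + b) +size≡ ⟨
      + size * + b
        ≡⟨ ℤ.pos-* size b ⟨
      + (size ℕ.* b)  ∎

  M = k ℕ.* k ℕ.+ k

  conclude : ∀ n → k ℕ.< n →
    (∃[ z ] n ≡ size ℕ.+ z ℕ.* M) ⊎ (∃[ z ] n ℕ.+ suc z ℕ.* M ≡ size) → HasNullity (A n k) d
  -- Here n ≥ `size`, so x = 0 and y = z; in the other case n is smaller, so x = z + 1 and y = 0.
  conclude n k<n (inj₁ (z , n≡)) = BandKernel.nullity k a c d k≡ d≤k {n} {0} {z} k<n (begin
    n ℕ.+ k ℕ.+ 0                     ≡⟨ cong (λ n → n ℕ.+ k ℕ.+ 0) n≡ ⟩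
    size ℕ.+ z ℕ.* M ℕ.+ k ℕ.+ 0      ≡⟨ arith size (z ℕ.* M) k ⟩
    size ℕ.+ k ℕ.+ z ℕ.* M            ≡⟨ cong (ℕ._+ z ℕ.* M) size+k ⟩
    d ℕ.* k ℕ.+ a ℕ.* suc d ℕ.+ d ℕ.+ z ℕ.* M  ∎)
    where
    arith : ∀ x y k → x ℕ.+ y ℕ.+ k ℕ.+ 0 ≡ x ℕ.+ k ℕ.+ y
    arith = ℕSolver.solve-∀
  conclude n k<n (inj₂ (z , n≡)) = BandKernel.nullity k a c d k≡ d≤k {n} {suc z} {0} k<n (begin
    n ℕ.+ k ℕ.+ suc z ℕ.* M           ≡⟨ arith n k (suc z ℕ.* M) ⟩
    n ℕ.+ suc z ℕ.* M ℕ.+ k ℕ.+ 0     ≡⟨ cong (λ n → n ℕ.+ k ℕ.+ 0) n≡ ⟩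
    size ℕ.+ k ℕ.+ 0                  ≡⟨ cong (ℕ._+ 0) size+k ⟩
    d ℕ.* k ℕ.+ a ℕ.* suc d ℕ.+ d ℕ.+ 0  ∎)
    where
    arith : ∀ n k x → n ℕ.+ k ℕ.+ x ≡ n ℕ.+ x ℕ.+ k ℕ.+ 0
    arith = ℕSolver.solve-∀
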